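{- $\widehat{\mathsf{WF}}\equiv_{sW}\widehat{\mathsf S_L}\equiv_{sW}\widehat{\mathsf S}$.
   Context: $\equiv_{sW}$ denotes strong Weihrauch equivalence; for a problem $\mathsf P$, the parallelization $\widehat{\mathsf P}$ takes a sequence of $\mathsf P$-inputs and outputs the sequence of corresponding $\mathsf P$-solutions. Graphs are countable, given by their vertex and edge sets. $\mathsf{WF}$: given a tree $T\subseteq\mathbb N^{<\mathbb N}$, output $0$ if $T$ contains an infinite path and $1$ if not. $\mathsf S$: given graphs $G$ and $H$, output $1$ if $H$ is isomorphic to a subgraph of $G$ and $0$ if not. $L$ is the linear graph with vertices $\{v_i:i\in\mathbb N\}$ and edges $\{(v_i,v_{i+1})\}$. $\mathsf S_L$: given a graph $G$, output $1$ if $L$ is isomorphic to a subgraph of $G$ and $0$ if not. -}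

module Defs where

open import Level using (0ℓ)
open import Data.Nat using (ℕ; zero; suc; _≡ᵇ_)
open import Data.Bool using (Bool; true; false; _∨_)
open import Data.List using (List; []; _∷_; _++_; [_])
open import Data.Product using (Σ; ∃; _×_; _,_)
open import Data.Sum using (_⊎_)
open import Relation.Nullary using (¬_)
open import Relation.Binary.PropositionalEquality using (_≡_)

-- Generic framework: partial multivalued problems and strong Weihrauch
-- reducibility, with reductions given by (constructive, hence computable)
-- Agda functions on the input/output data.

record Problem : Set₁ where
  field
    In  : Set
    Dom : In → Set
    Out : Set
    Sol : In → Out → Set

open Problem public

_≤sW_ : Problem → Problem → Set
P ≤sW Q =
  Σ (In P → In Q) λ Φ →
  Σ (Out Q → Out P) λ Ψ →
  (x : In P) → Dom P x →
    Dom Q (Φ x) × ((y : Out Q) → Sol Q (Φ x) y → Sol P x (Ψ y))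

_≡sW_ : Problem → Problem → Set
P ≡sW Q = (P ≤sW Q) × (Q ≤sW P)

par : Problem → Problem
par P = record
  { In  = ℕ → In P
  ; Dom = λ xs → (n : ℕ) → Dom P (xs n)
  ; Out = ℕ → Out P
  ; Sol = λ xs ys → (n : ℕ) → Sol P (xs n) (ys n)
  }

Tree : Set
Tree = List ℕ → Bool

IsTree : Tree → Set
IsTree T = (σ : List ℕ) (n : ℕ) → T (σ ++ [ n ]) ≡ true → T σ ≡ true

take : (ℕ → ℕ) → ℕ → List ℕ
take p zero    = []
take p (suc n) = take p n ++ [ p n ]

HasInfinitePath : Tree → Set
HasInfinitePath T = Σ (ℕ → ℕ) λ p → (n : ℕ) → T (take p n) ≡ true

WF : Problem
WF = record
  { In  = Tree
  ; Dom = IsTree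
  ; Out = ℕ
  ; Sol = λ T b → (b ≡ 0 × HasInfinitePath T) ⊎ (b ≡ 1 × ¬ HasInfinitePath T)
  }

record Graph : Set where
  field
    V : ℕ → Bool
    E : ℕ → ℕ → Bool
open Graph public

IsGraph : Graph → Set
IsGraph G =
  ((x y : ℕ) → E G x y ≡ true → (V G x ≡ true) × (V G y ≡ true)) ×
  ((x y : ℕ) → E G x y ≡ true → E G y x ≡ true) ×
  ((x : ℕ) → ¬ (E G x x ≡ true))

-- H is isomorphic to a (not necessarily induced) subgraph of G.
IsoToSubgraph : Graph → Graph → Set
IsoToSubgraph H G =
  Σ (ℕ → ℕ) λ f →
    ((v : ℕ) → V H v ≡ true → V G (f v) ≡ true) ×
    ((u v : ℕ) → V H u ≡ true → V H v ≡ true → f u ≡ f v → u ≡ v) ×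
    ((u v : ℕ) → E H u v ≡ true → E G (f u) (f v) ≡ true)

S : Problem
S = record
  { In  = Graph × Graph
  ; Dom = λ { (G , H) → IsGraph G × IsGraph H }
  ; Out = ℕ
  ; Sol = λ { (G , H) b → (b ≡ 1 × IsoToSubgraph H G) ⊎ (b ≡ 0 × ¬ IsoToSubgraph H G) }
  }

L : Graph
L = record
  { V = λ _ → true
  ; E = λ i j → (j ≡ᵇ suc i) ∨ (i ≡ᵇ suc j)
  }

S-L : Problem
S-L = record
  { In  = Graph
  ; Dom = IsGraph
  ; Out = ℕ
  ; Sol = λ G b → (b ≡ 1 × IsoToSubgraph L G) ⊎ (b ≡ 0 × ¬ IsoToSubgraph L G)
  }

{-# OPTIONS --safe #-}
module Submission where

-- The problems reduce to one another in the cycle S-L ≤sW S ≤sW WF ≤sW S-L, and parallelisation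
-- is monotone. S-L is the instance H = L of S. S reduces to WF via the tree of finite partial
-- embeddings of H into G (a list σ sends vertex u to its u-th entry), whose infinite paths are
-- exactly the embeddings. WF reduces to S-L by viewing a tree as the graph on (codes of) its
-- nodes, each node adjacent to its one-entry extensions: an infinite path is a ray. Conversely,
-- a ray never revisits a node, so after one step down it can never step up again (that would
-- return to the node before), and it can step up only as often as the length of its first node.
-- Hence it eventually descends forever, and the nodes it passes spell out an infinite path.

open import Defs
open import Data.Bool using (true)
open import Data.Bool.Properties using (T-≡; T-∨; ∨-comm) renaming (_≟_ to _≟ᵇ_)
open import Data.Empty using (⊥-elim)
open import Data.List using (List; []; _∷_; _++_; [_]; _∷ʳ_; length; _∷ʳ′_; initLast)
open import Data.List.Properties using (length-++; length-++-≤ˡ; ++-assoc; ++-identityʳ; ∷ʳ-injectiveˡ; ≡-dec)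
open import Data.Nat using (ℕ; zero; suc; _+_; _∸_; _≡ᵇ_; _<_; s≤s)
open import Data.Nat.Binary using (ℕᵇ; 2[1+_]; 1+[2_]) renaming (zero to zeroᵇ; toℕ to toℕᵇ; fromℕ to fromℕᵇ)
open import Data.Nat.Binary.Properties using (fromℕ-toℕ)
open import Data.Nat.Properties
  using (_≟_; ≡ᵇ⇒≡; +-comm; +-suc; +-identityʳ; 0≢1+n; 1+n≢n; m≢1+n+m; suc-injective; m≤m+n; m≤n+m; <-≤-trans; allUpTo?)
open import Data.Product using (∃; _×_; _,_; proj₁; proj₂)
open import Data.Sum using (_⊎_; inj₁; inj₂; swap)
import Data.Sum as Sum
open import Function using (_∘_; id)
open import Function.Bundles using (Equivalence; _⇔_; mk⇔)
open import Relation.Nullary using (¬_; Dec; yes; no; does)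
open import Relation.Nullary.Decidable using (dec-true; _×-dec_; _⊎-dec_; _→-dec_)
open import Relation.Binary.PropositionalEquality using (_≡_; refl; sym; trans; cong; subst; subst₂; module ≡-Reasoning)

≤sW-trans : ∀ {P Q R} → P ≤sW Q → Q ≤sW R → P ≤sW R
≤sW-trans (Φ , Ψ , h) (Φ′ , Ψ′ , h′) =
  Φ′ ∘ Φ , Ψ ∘ Ψ′ , λ x d →
    let dQ , back = h x d
        dR , back′ = h′ (Φ x) dQ
    in dR , λ y s → back (Ψ′ y) (back′ y s)

par-monotone : ∀ {P Q} → P ≤sW Q → par P ≤sW par Q
par-monotone (Φ , Ψ , h) =
  (λ xs n → Φ (xs n)) , (λ ys n → Ψ (ys n)) ,
  λ xs d → (λ n → proj₁ (h (xs n) (d n))) , λ ys s n → proj₂ (h (xs n) (d n)) (ys n) (s n)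

decided : ∀ {A : Set} (a? : Dec A) → does a? ≡ true → A
decided (yes a) _ = a

take-suc : ∀ (p : ℕ → ℕ) n → take p (suc n) ≡ p 0 ∷ take (p ∘ suc) n
take-suc p zero    = refl
take-suc p (suc n) = cong (_∷ʳ p (suc n)) (take-suc p n)

length-take : ∀ p n → length (take p n) ≡ n
length-take p zero    = refl
length-take p (suc n) = trans (cong length (take-suc p n)) (cong suc (length-take (p ∘ suc) n))

take-injective : ∀ p {m n} → take p m ≡ take p n → m ≡ n
take-injective p {m} {n} e = trans (sym (length-take p m)) (trans (cong length e) (length-take p n))

nth : List ℕ → ℕ → ℕ
nth []      _       = 0
nth (x ∷ σ) zero    = x
nth (x ∷ σ) (suc u) = nth σ u

nth-++ˡ : ∀ σ ρ {u} → u < length σ → nth (σ ++ ρ) u ≡ nth σ u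
nth-++ˡ (x ∷ σ) ρ {zero}  _         = refl
nth-++ˡ (x ∷ σ) ρ {suc u} (s≤s u<σ) = nth-++ˡ σ ρ u<σ

nth-take : ∀ p n {u} → u < n → nth (take p n) u ≡ p u
nth-take p (suc n) {zero}  _         = cong (λ σ → nth σ 0) (take-suc p n)
nth-take p (suc n) {suc u} (s≤s u<n) =
  trans (cong (λ σ → nth σ (suc u)) (take-suc p n)) (nth-take (p ∘ suc) n u<n)

prepend : List ℕ → (ℕ → ℕ) → ℕ → ℕ
prepend []      p n       = p n
prepend (x ∷ σ) p zero    = x
prepend (x ∷ σ) p (suc n) = prepend σ p n

take-prepend : ∀ σ p n → take (prepend σ p) (length σ + n) ≡ σ ++ take p n
take-prepend []      p n = refl
take-prepend (x ∷ σ) p n =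
  trans (take-suc (prepend (x ∷ σ) p) (length σ + n)) (cong (x ∷_) (take-prepend σ p n))

_⋖_ : List ℕ → List ℕ → Set
σ ⋖ τ = ∃ λ x → τ ≡ σ ∷ʳ x

⋖-length : ∀ {σ τ} → σ ⋖ τ → length τ ≡ suc (length σ)
⋖-length {σ} (x , refl) = trans (length-++ σ) (+-comm (length σ) 1)

⋖-irrefl : ∀ {σ} → ¬ (σ ⋖ σ)
⋖-irrefl child = 1+n≢n (sym (⋖-length child))

_⋖?_ : ∀ σ τ → Dec (σ ⋖ τ)
σ ⋖? τ with initLast τ
... | []      = no (0≢1+n ∘ ⋖-length)
... | ρ ∷ʳ′ x with ≡-dec _≟_ σ ρ
...   | yes refl = yes (x , refl)
...   | no σ≢ρ   = no λ (y , e) → σ≢ρ (sym (∷ʳ-injectiveˡ ρ σ e))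

module _ {T : Tree} (isTree : IsTree T) where

  take-downward : ∀ p m n → T (take p (m + n)) ≡ true → T (take p n) ≡ true
  take-downward p zero    n t = t
  take-downward p (suc m) n t = take-downward p m n (isTree (take p (m + n)) (p (m + n)) t)

  chain⇒path : (τ : ℕ → List ℕ) → (∀ k → τ k ⋖ τ (suc k)) → (∀ k → T (τ k) ≡ true) →
               HasInfinitePath T
  chain⇒path τ child inT =
    p , λ n → take-downward p (length (τ 0)) n (subst (λ σ → T σ ≡ true) (τ≡take n) (inT n))
    where
    x : ℕ → ℕ
    x k = proj₁ (child k)

    p : ℕ → ℕ
    p = prepend (τ 0) x

    τ≡τ0++take : ∀ k → τ k ≡ τ 0 ++ take x k
    τ≡τ0++take zero    = sym (++-identityʳ (τ 0))
    τ≡τ0++take (suc k) = begin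
      τ (suc k)                     ≡⟨ proj₂ (child k) ⟩
      τ k ∷ʳ x k                    ≡⟨ cong (_∷ʳ x k) (τ≡τ0++take k) ⟩
      (τ 0 ++ take x k) ∷ʳ x k      ≡⟨ ++-assoc (τ 0) (take x k) [ x k ] ⟩
      τ 0 ++ take x (suc k)         ∎
      where open ≡-Reasoning

    τ≡take : ∀ n → τ n ≡ take p (length (τ 0) + n)
    τ≡take n = trans (τ≡τ0++take n) (sym (take-prepend (τ 0) x n))

module _ {s : ℕ → List ℕ} (s-injective : ∀ {i j} → s i ≡ s j → i ≡ j)
         (step : ∀ i → s i ⋖ s (suc i) ⊎ s (suc i) ⋖ s i) where

  descent-persists : ∀ i → s i ⋖ s (suc i) → s (suc i) ⋖ s (suc (suc i))
  descent-persists i (x , down) with step (suc i)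
  ... | inj₁ down′    = down′
  ... | inj₂ (y , up) =
    ⊥-elim (m≢1+n+m i {1} (s-injective (∷ʳ-injectiveˡ (s i) (s (suc (suc i))) (trans (sym down) up))))

  descent-within : ∀ n i → length (s i) ≡ n → ∃ λ k → s k ⋖ s (suc k)
  descent-within n i len with step i
  ... | inj₁ down = i , down
  descent-within zero    i len | inj₂ up = ⊥-elim (0≢1+n (trans (sym len) (⋖-length up)))
  descent-within (suc n) i len | inj₂ up =
    descent-within n (suc i) (suc-injective (trans (sym (⋖-length up)) len))

  descent-persists-forever : ∀ {k} → s k ⋖ s (suc k) → ∀ j → s (j + k) ⋖ s (suc (j + k))
  descent-persists-forever down zero    = down
  descent-persists-forever down (suc j) = descent-persists _ (descent-persists-forever down j)

  eventually-descending : ∃ λ k → ∀ j → s (j + k) ⋖ s (suc (j + k))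
  eventually-descending =
    let k , down = descent-within (length (s 0)) 0 refl
    in k , descent-persists-forever down

Compatible : Graph → Graph → ℕ → ℕ → ℕ → ℕ → Set
Compatible G H u v a b =
  (V H u ≡ true → V G a ≡ true) ×
  (V H u ≡ true → V H v ≡ true → a ≡ b → u ≡ v) ×
  (E H u v ≡ true → E G a b ≡ true)

compatible? : ∀ G H u v a b → Dec (Compatible G H u v a b)
compatible? G H u v a b =
  ((V H u ≟ᵇ true) →-dec (V G a ≟ᵇ true)) ×-dec
  ((V H u ≟ᵇ true) →-dec (V H v ≟ᵇ true) →-dec (a ≟ b) →-dec (u ≟ v)) ×-dec
  ((E H u v ≟ᵇ true) →-dec (E G a b ≟ᵇ true))

module _ (G H : Graph) where

  PartialEmbedding : List ℕ → Set
  PartialEmbedding σ =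
    ∀ {u} → u < length σ → ∀ {v} → v < length σ → Compatible G H u v (nth σ u) (nth σ v)

  partialEmbedding? : ∀ σ → Dec (PartialEmbedding σ)
  partialEmbedding? σ =
    allUpTo? (λ u → allUpTo? (λ v → compatible? G H u v (nth σ u) (nth σ v)) (length σ)) (length σ)

  partialEmbedding-take : ∀ p n → PartialEmbedding (take p n) ⇔
    (∀ {u} → u < n → ∀ {v} → v < n → Compatible G H u v (p u) (p v))
  partialEmbedding-take p n = mk⇔
    (λ emb {u} u<n {v} v<n →
       subst₂ (Compatible G H u v) (nth-take p n u<n) (nth-take p n v<n) (emb (bound u<n) (bound v<n)))
    (λ emb {u} u<σ {v} v<σ →
       let u<n = unbound u<σ ; v<n = unbound v<σ
       in subst₂ (Compatible G H u v) (sym (nth-take p n u<n)) (sym (nth-take p n v<n)) (emb u<n v<n))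
    where
    bound : ∀ {u} → u < n → u < length (take p n)
    bound = subst (_ <_) (sym (length-take p n))

    unbound : ∀ {u} → u < length (take p n) → u < n
    unbound = subst (_ <_) (length-take p n)

  embeddingTree : Tree
  embeddingTree σ = does (partialEmbedding? σ)

  embeddingTree-isTree : IsTree embeddingTree
  embeddingTree-isTree σ x extended = dec-true (partialEmbedding? σ) λ u<σ v<σ →
    subst₂ (Compatible G H _ _) (nth-++ˡ σ [ x ] u<σ) (nth-++ˡ σ [ x ] v<σ)
      (decided (partialEmbedding? (σ ∷ʳ x)) extended (extend u<σ) (extend v<σ))
    where
    extend : ∀ {u} → u < length σ → u < length (σ ∷ʳ x)
    extend u<σ = <-≤-trans u<σ (length-++-≤ˡ σ)

  embedding⇒path : IsoToSubgraph H G → HasInfinitePath embeddingTree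
  embedding⇒path (f , f-V , f-inj , f-E) = f , λ n →
    dec-true (partialEmbedding? (take f n))
      (Equivalence.from (partialEmbedding-take f n) λ {u} _ {v} _ → f-V u , f-inj u v , f-E u v)

  path⇒embedding : HasInfinitePath embeddingTree → IsoToSubgraph H G
  path⇒embedding (p , inT) =
    p , (λ v → proj₁ (compatible v v)) , (λ u v → proj₁ (proj₂ (compatible u v))) ,
    λ u v → proj₂ (proj₂ (compatible u v))
    where
    compatible : ∀ u v → Compatible G H u v (p u) (p v)
    compatible u v =
      Equivalence.to (partialEmbedding-take p (suc (u + v)))
        (decided (partialEmbedding? (take p (suc (u + v)))) (inT (suc (u + v))))
        (s≤s (m≤m+n u v)) (s≤s (m≤n+m v u))

S≤WF : S ≤sW WF
S≤WF = (λ (G , H) → embeddingTree G H) , 1 ∸_ , λ (G , H) _ → embeddingTree-isTree G H , λ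
  { _ (inj₁ (refl , path))    → inj₁ (refl , path⇒embedding G H path)
  ; _ (inj₂ (refl , no-path)) → inj₂ (refl , no-path ∘ embedding⇒path G H) }

-- An entry x becomes x bits 1+[2_] followed by one bit 2[1+_]; decoding counts the 1+[2_] bits.
ones : ℕ → ℕᵇ → ℕᵇ
ones zero    b = b
ones (suc x) b = 1+[2 ones x b ]

encodeᵇ : List ℕ → ℕᵇ
encodeᵇ []      = zeroᵇ
encodeᵇ (x ∷ σ) = ones x 2[1+ encodeᵇ σ ]

decodeᵇ : ℕ → ℕᵇ → List ℕ
decodeᵇ k zeroᵇ    = []
decodeᵇ k 2[1+ b ] = k ∷ decodeᵇ 0 b
decodeᵇ k 1+[2 b ] = decodeᵇ (suc k) b

decodeᵇ-ones : ∀ k x b → decodeᵇ k (ones x b) ≡ decodeᵇ (k + x) b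
decodeᵇ-ones k zero    b = cong (λ j → decodeᵇ j b) (sym (+-identityʳ k))
decodeᵇ-ones k (suc x) b = trans (decodeᵇ-ones (suc k) x b) (cong (λ j → decodeᵇ j b) (sym (+-suc k x)))

decodeᵇ-encodeᵇ : ∀ σ → decodeᵇ 0 (encodeᵇ σ) ≡ σ
decodeᵇ-encodeᵇ []      = refl
decodeᵇ-encodeᵇ (x ∷ σ) = trans (decodeᵇ-ones 0 x _) (cong (x ∷_) (decodeᵇ-encodeᵇ σ))

code : List ℕ → ℕ
code = toℕᵇ ∘ encodeᵇ

decode : ℕ → List ℕ
decode = decodeᵇ 0 ∘ fromℕᵇ

decode-code : ∀ σ → decode (code σ) ≡ σ
decode-code σ = trans (cong (decodeᵇ 0) (fromℕ-toℕ (encodeᵇ σ))) (decodeᵇ-encodeᵇ σ)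

code-injective : ∀ {σ τ} → code σ ≡ code τ → σ ≡ τ
code-injective {σ} {τ} e = trans (sym (decode-code σ)) (trans (cong decode e) (decode-code τ))

L-successor : ∀ i → E L i (suc i) ≡ true
L-successor zero    = refl
L-successor (suc i) = L-successor i

L-adjacent : ∀ {u v} → E L u v ≡ true → v ≡ suc u ⊎ u ≡ suc v
L-adjacent {u} {v} e =
  Sum.map (≡ᵇ⇒≡ v (suc u)) (≡ᵇ⇒≡ u (suc v)) (Equivalence.to T-∨ (Equivalence.from T-≡ e))

L-isGraph : IsGraph L
L-isGraph =
  (λ _ _ _ → refl , refl) ,
  (λ u v e → trans (∨-comm (u ≡ᵇ suc v) (v ≡ᵇ suc u)) e) ,
  λ u e → Sum.[ 1+n≢n ∘ sym , 1+n≢n ∘ sym ]′ (L-adjacent {u} {u} e)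

module _ (T : Tree) where

  -- Only canonical codes are vertices, so that distinct vertices are distinct nodes.
  Node : ℕ → Set
  Node n = T (decode n) ≡ true × code (decode n) ≡ n

  Adjacent : ℕ → ℕ → Set
  Adjacent m n = Node m × Node n × (decode m ⋖ decode n ⊎ decode n ⋖ decode m)

  node? : ∀ n → Dec (Node n)
  node? n = (T (decode n) ≟ᵇ true) ×-dec (code (decode n) ≟ n)

  adjacent? : ∀ m n → Dec (Adjacent m n)
  adjacent? m n = node? m ×-dec node? n ×-dec ((decode m ⋖? decode n) ⊎-dec (decode n ⋖? decode m))

  adjacent-sym : ∀ {m n} → Adjacent m n → Adjacent n m
  adjacent-sym (m-node , n-node , link) = n-node , m-node , swap link

  node-code : ∀ {σ} → T σ ≡ true → Node (code σ)
  node-code {σ} t = subst (λ τ → T τ ≡ true) (sym (decode-code σ)) t , cong code (decode-code σ)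

  treeGraph : Graph
  treeGraph = record { V = λ n → does (node? n) ; E = λ m n → does (adjacent? m n) }

  treeGraph-isGraph : IsGraph treeGraph
  treeGraph-isGraph =
    (λ m n e → let m-node , n-node , _ = decided (adjacent? m n) e
               in dec-true (node? m) m-node , dec-true (node? n) n-node) ,
    (λ m n e → dec-true (adjacent? n m) (adjacent-sym (decided (adjacent? m n) e))) ,
    λ n e → Sum.[ ⋖-irrefl , ⋖-irrefl ]′ (proj₂ (proj₂ (decided (adjacent? n n) e)))

  path⇒ray : HasInfinitePath T → IsoToSubgraph L treeGraph
  path⇒ray (p , inT) = f , (λ n _ → dec-true (node? (f n)) (node-code (inT n))) , injective , edge
    where
    f : ℕ → ℕ
    f n = code (take p n)

    injective : ∀ u v → V L u ≡ true → V L v ≡ true → f u ≡ f v → u ≡ v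
    injective u v _ _ = take-injective p ∘ code-injective

    descends : ∀ n → Adjacent (f n) (f (suc n))
    descends n = node-code (inT n) , node-code (inT (suc n)) ,
      inj₁ (subst₂ _⋖_ (sym (decode-code (take p n))) (sym (decode-code (take p (suc n)))) (p n , refl))

    edge : ∀ u v → E L u v ≡ true → E treeGraph (f u) (f v) ≡ true
    edge u v e with L-adjacent {u} {v} e
    ... | inj₁ refl = dec-true (adjacent? (f u) (f v)) (descends u)
    ... | inj₂ refl = dec-true (adjacent? (f u) (f v)) (adjacent-sym (descends v))

  ray⇒path : IsTree T → IsoToSubgraph L treeGraph → HasInfinitePath T
  ray⇒path isTree (f , f-V , f-inj , f-E) =
    let k , descending = eventually-descending s-injective step
    in chain⇒path isTree (λ j → s (j + k)) descending (λ j → proj₁ (node (j + k)))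
    where
    node : ∀ i → Node (f i)
    node i = decided (node? (f i)) (f-V i refl)

    s : ℕ → List ℕ
    s i = decode (f i)

    s-injective : ∀ {i j} → s i ≡ s j → i ≡ j
    s-injective {i} {j} e =
      f-inj i j refl refl (trans (sym (proj₂ (node i))) (trans (cong code e) (proj₂ (node j))))

    step : ∀ i → s i ⋖ s (suc i) ⊎ s (suc i) ⋖ s i
    step i = proj₂ (proj₂ (decided (adjacent? (f i) (f (suc i))) (f-E i (suc i) (L-successor i))))

WF≤SL : WF ≤sW S-L
WF≤SL = treeGraph , 1 ∸_ , λ T isTree → treeGraph-isGraph T , λ
  { _ (inj₁ (refl , ray))    → inj₁ (refl , ray⇒path T isTree ray)
  ; _ (inj₂ (refl , no-ray)) → inj₂ (refl , no-ray ∘ path⇒ray T) }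

SL≤S : S-L ≤sW S
SL≤S = (λ G → G , L) , id , λ G isGraph → (isGraph , L-isGraph) , λ _ answer → answer

corollary26 : (par WF ≡sW par S-L) × (par S-L ≡sW par S)
corollary26 =
  (par-monotone {WF} {S-L} WF≤SL , par-monotone {S-L} {WF} SL≤WF) ,
  (par-monotone {S-L} {S} SL≤S , par-monotone {S} {S-L} S≤SL)
  where
  SL≤WF : S-L ≤sW WF
  SL≤WF = ≤sW-trans {S-L} {S} {WF} SL≤S S≤WF

  S≤SL : S ≤sW S-L
  S≤SL = ≤sW-trans {S} {WF} {S-L} S≤WF WF≤SL
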